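{- Let $n \in \mathbb{N}$, let $\lambda,\mu \in \mathbb{Z}^n$, and let $\mathbf{x} \in X_n$ be a GT-pattern lying in the Gelfand--Tsetlin polytope $GT(\lambda,\mu)$. Let $\mathscr{P}$ be the tiling of $\mathbf{x}$, with $s$ free tiles, and let $A_{\mathscr{P}}$ be its tiling matrix, regarded as a linear map on $\mathbb{R}^s$. Then the dimension of the kernel of $A_{\mathscr{P}}$ is equal to the dimension of the minimal (lowest-dimensional) face of $GT(\lambda,\mu)$ containing $\mathbf{x}$.
   Context: For $n\in\mathbb{N}$, $X_n$ is the real vector space of all triangular arrays $(x_{ij})_{1\le i\le j\le n}$ with $x_{ij}\in\mathbb{R}$, so $X_n \cong \mathbb{R}^{n(n+1)/2}$. For fixed $j$, the entries $x_{1j},\dots,x_{jj}$ form the $j$th row; the $n$th row is the top row and $x_{11}$ is the bottom row. A Gelfand--Tsetlin pattern (GT-pattern) is an array $(x_{ij})_{1\le i\le j\le n}\in X_n$ with $x_{ij}\ge 0$ for $1\le i\le j\le n$ and $x_{i,j+1}\ge x_{ij}\ge x_{i+1,j+1}$ for $1\le i\le j\le n-1$. For $\lambda,\mu\in\mathbb{Z}^n$, the Gelfand--Tsetlin polytope (GT-polytope) $GT(\lambda,\mu)\subset X_n$ is the convex polytope of all GT-patterns $(x_{ij})$ with $x_{in}=\lambda_i$ for $1\le i\le n$, $x_{11}=\mu_1$, and $\sum_{i=1}^{j}x_{ij}-\sum_{i=1}^{j-1}x_{i,j-1}=\mu_j$ for $2\le j\le n$. The tiling $\mathscr{P}$ of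 a GT-pattern $\mathbf{x}\in X_n$ is the partition of $\{(i,j)\in\mathbb{Z}^2: 1\le i\le j\le n\}$ into subsets, called tiles, obtained by grouping together entries that are equal and adjacent: two pairs $(i,j),(\tilde i,\tilde j)$ in this index set are in the same tile iff there is a sequence of pairs $(i,j)=(i_1,j_1),(i_2,j_2),\dots,(i_r,j_r)=(\tilde i,\tilde j)$ in the index set such that, for each $k\in\{1,\dots,r-1\}$, $x_{i_{k+1}j_{k+1}}=x_{i_kj_k}$ and $(i_{k+1},j_{k+1})\in\{(i_k+1,j_k+1),(i_k,j_k+1),(i_k-1,j_k-1),(i_k,j_k-1)\}$. The free tiles $P_1,\dots,P_s$ of $\mathscr{P}$ are the tiles that do not contain $(1,1)$ and do not contain $(i,n)$ for any $1\le i\le n$ (the order of indexing is immaterial). The tiling matrix $A_{\mathscr{P}}=(a_{jk})_{2\le j\le n-1,\,1\le k\le s}$ is defined by $a_{jk}=\#\{i:(i,j)\in P_k\}$. -}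

module Defs where

open import Algebra.Bundles using (CommutativeRing)
open import Algebra.Module.Bundles.Raw using (RawLeftModule)
import Algebra.Module.Construct.TensorUnit as TensorUnit
open import Algebra.Module.Morphism.Structures using (module LeftModuleMorphisms)
import Algebra.Definitions.RawMonoid as RawMonoidDefinitions
open import Data.Fin.Base using (Fin; toℕ)
open import Data.Integer.Base using (ℤ; +_; -[1+_])
open import Data.Nat.Base as ℕ using (ℕ; suc)
open import Data.Product.Base using (Σ-syntax; ∃-syntax; _×_; _,_; proj₁)
open import Data.Sum.Base using (_⊎_)
open import Data.Vec.Base using (allFin; count)
open import Data.Vec.Functional using (Vector)
open import Level as Level using (0ℓ)
open import Relation.Binary.Core using (Rel)
open import Relation.Binary.Construct.Closure.ReflexiveTransitive using (Star)
open import Relation.Binary.PropositionalEquality.Core using (_≡_)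
open import Relation.Binary.Structures using (IsDecTotalOrder)
open import Relation.Nullary.Negation.Core using (¬_)
open import Relation.Unary using (Pred; Decidable; Satisfiable; _∈_; _⊆_; _≐_)

-- The axioms of a Dedekind-complete ordered field, which determine ℝ up to
-- isomorphism.  As in classical mathematics, the order is decidable.
record RealField : Set (Level.suc 0ℓ) where
  field
    commutativeRing : CommutativeRing 0ℓ 0ℓ

  open CommutativeRing commutativeRing public

  infix 4 _≤_
  field
    0≉1             : ¬ (0# ≈ 1#)
    inverse         : ∀ a → ¬ (a ≈ 0#) → ∃[ b ] a * b ≈ 1#
    _≤_             : Rel Carrier 0ℓ
    isDecTotalOrder : IsDecTotalOrder _≈_ _≤_
    +-monoˡ-≤       : ∀ {a b} c → a ≤ b → a + c ≤ b + c
    *-nonNeg        : ∀ {a b} → 0# ≤ a → 0# ≤ b → 0# ≤ a * b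

  UpperBound : Pred Carrier 0ℓ → Pred Carrier 0ℓ
  UpperBound S b = ∀ {a} → a ∈ S → a ≤ b

  field
    supremum : ∀ (S : Pred Carrier 0ℓ) → Satisfiable S → Satisfiable (UpperBound S) →
               ∃[ s ] s ∈ UpperBound S × (∀ {b} → b ∈ UpperBound S → s ≤ b)

-- (j , i) is the position in row suc (toℕ j) and column suc (toℕ i); row and col
-- give the 1-based coordinates, so 1 ≤ col c ≤ row c ≤ n.
Cell : ℕ → Set
Cell n = Σ[ j ∈ Fin n ] Fin (suc (toℕ j))

row col : ∀ {n} → Cell n → ℕ
row (j , i) = suc (toℕ j)
col (j , i) = suc (toℕ i)

-- With a = (i,j) in (column, row) coordinates: b = (i,j+1), resp. b = (i+1,j+1).
_UpTo_ _DiagTo_ : ∀ {n} → Rel (Cell n) 0ℓ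
a UpTo   b = col b ≡ col a       × row b ≡ suc (row a)
a DiagTo b = col b ≡ suc (col a) × row b ≡ suc (row a)

Adjacent : ∀ {n} → Rel (Cell n) 0ℓ
Adjacent a b = a DiagTo b ⊎ a UpTo b ⊎ b DiagTo a ⊎ b UpTo a

-- The rows 2 ≤ j ≤ n-1.
InnerRow : ℕ → Set
InnerRow n = Σ[ j ∈ Fin n ] (2 ℕ.≤ suc (toℕ j) × suc (toℕ j) ℕ.< n)

module GelfandTsetlin (ℝ : RealField) where

  open RealField ℝ
  open RawMonoidDefinitions +-rawMonoid using (sum) renaming (_×_ to _·_)

  fromℕ : ℕ → Carrier
  fromℕ m = m · 1#

  fromℤ : ℤ → Carrier
  fromℤ (+ m)    = fromℕ m
  fromℤ -[1+ m ] = - fromℕ (suc m)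

  -- The real vector space of functions I → ℝ, with pointwise structure.
  ℝ^ : Set → RawLeftModule Carrier 0ℓ 0ℓ
  ℝ^ I = record
    { Carrierᴹ = I → Carrier
    ; _≈ᴹ_     = λ u v → ∀ p → u p ≈ v p
    ; _+ᴹ_     = λ u v p → u p + v p
    ; _*ₗ_     = λ a v p → a * v p
    ; 0ᴹ       = λ _ → 0#
    ; -ᴹ_      = λ v p → - v p
    }

  module _ {I : Set} where
    open RawLeftModule (ℝ^ I) using (Carrierᴹ; _≈ᴹ_; _+ᴹ_; -ᴹ_; 0ᴹ)

    IsLinearFunctional : Pred (Carrierᴹ → Carrier) 0ℓ
    IsLinearFunctional = IsLeftModuleHomomorphism
      where open LeftModuleMorphisms (ℝ^ I) (TensorUnit.rawLeftModule {R = rawRing})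

    combination : ∀ {m} → Vector Carrier m → Vector Carrierᴹ m → Carrierᴹ
    combination c v p = sum (λ k → c k * v k p)

    LinearlyIndependent : ∀ {m} → Pred (Vector Carrierᴹ m) 0ℓ
    LinearlyIndependent v = ∀ c → combination c v ≈ᴹ 0ᴹ → ∀ k → c k ≈ 0#

    HasDimension : Pred Carrierᴹ 0ℓ → ℕ → Set
    HasDimension W d = Σ[ b ∈ Vector Carrierᴹ d ]
      (∀ k → b k ∈ W)
      × LinearlyIndependent b
      × (∀ {w} → w ∈ W → ∃[ c ] w ≈ᴹ combination c b)

    affineHull : Pred Carrierᴹ 0ℓ → Pred Carrierᴹ 0ℓ
    affineHull S y = ∃[ m ] Σ[ c ∈ Vector Carrier m ] Σ[ p ∈ Vector Carrierᴹ m ]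
      (∀ k → p k ∈ S) × sum c ≈ 1# × y ≈ᴹ combination c p

    direction : Pred Carrierᴹ 0ℓ → Pred Carrierᴹ 0ℓ
    direction A v = ∃[ a ] ∃[ b ] a ∈ A × b ∈ A × v ≈ᴹ (a +ᴹ (-ᴹ b))

    -- Meaningful for nonempty S only: the empty set would get 0 rather than -1.
    HasAffineDimension : Pred Carrierᴹ 0ℓ → ℕ → Set
    HasAffineDimension S = HasDimension (direction (affineHull S))

    -- F = P ∩ {f = c} for an inequality f ≤ c valid on P.  P itself is a face
    -- (f = 0, c = 0).
    IsFaceOf : Pred Carrierᴹ 0ℓ → Pred Carrierᴹ 0ℓ → Set
    IsFaceOf P F = Σ[ f ∈ (Carrierᴹ → Carrier) ] Σ[ c ∈ Carrier ]
      IsLinearFunctional f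
      × (∀ {y} → y ∈ P → f y ≤ c)
      × F ≐ (λ y → y ∈ P × f y ≈ c)

    record IsMinimalFace (P : Pred Carrierᴹ 0ℓ) (x : Carrierᴹ) (F : Pred Carrierᴹ 0ℓ)
           : Set (Level.suc 0ℓ) where
      field
        isFace            : IsFaceOf P F
        contains          : x ∈ F
        least             : ∀ {G} → IsFaceOf P G → x ∈ G → F ⊆ G
        lowestDimensional : ∀ {G d e} → IsFaceOf P G → x ∈ G →
                            HasAffineDimension F d → HasAffineDimension G e → d ℕ.≤ e

  applyMatrix : ∀ {J : Set} {s} → (J → Fin s → Carrier) → Vector Carrier s → J → Carrier
  applyMatrix A v j = sum (λ k → A j k * v k)

  kernel : ∀ {J : Set} {s} → (J → Fin s → Carrier) → Pred (Vector Carrier s) 0ℓ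
  kernel A v = ∀ j → applyMatrix A v j ≈ 0#

  X : ℕ → Set
  X n = Cell n → Carrier

  record IsGTPattern {n} (x : X n) : Set where
    field
      nonNeg : ∀ a → 0# ≤ x a
      up     : ∀ {a b} → a UpTo b → x a ≤ x b
      diag   : ∀ {a b} → a DiagTo b → x b ≤ x a

  rowSum : ∀ {n} → X n → Fin n → Carrier
  rowSum x j = sum (λ i → x (j , i))

  record GT {n} (lam μ : Vector ℤ n) (x : X n) : Set where
    field
      isGTPattern : IsGTPattern x
      top         : ∀ a k → row a ≡ n → col a ≡ suc (toℕ k) → x a ≈ fromℤ (lam k)
      bottom      : ∀ a → row a ≡ 1 → x a ≈ fromℤ (μ (proj₁ a))
      weight      : ∀ j j⁺ → toℕ j⁺ ≡ suc (toℕ j) →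
                    rowSum x j⁺ - rowSum x j ≈ fromℤ (μ j⁺)

  module _ {n} (x : X n) where

    SameTile : Rel (Cell n) 0ℓ
    SameTile = Star (λ a b → x b ≈ x a × Adjacent a b)

    IsTile : Pred (Pred (Cell n) 0ℓ) 0ℓ
    IsTile T = ∃[ a ] T ≐ SameTile a

    IsFreeTile : Pred (Pred (Cell n) 0ℓ) 0ℓ
    IsFreeTile T = IsTile T × (∀ {a} → a ∈ T → ¬ (row a ≡ 1) × ¬ (row a ≡ n))

    -- A listing P₁,…,Pₛ of the free tiles, in any order and without repetition.
    -- Membership is decidable, as the cells are finitely many and _≈_ is decidable.
    record FreeTiles : Set (Level.suc 0ℓ) where
      field
        s          : ℕ
        P          : Fin s → Pred (Cell n) 0ℓ
        P?         : ∀ k → Decidable (P k)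
        isFree     : ∀ k → IsFreeTile (P k)
        distinct   : ∀ {k l} → P k ≐ P l → k ≡ l
        exhaustive : ∀ {T} → IsFreeTile T → ∃[ k ] T ≐ P k

  tilingMatrix : ∀ {n} {x : X n} (𝒫 : FreeTiles x) →
                 InnerRow n → Fin (FreeTiles.s 𝒫) → Carrier
  tilingMatrix 𝒫 (j , _) k =
    fromℕ (count (λ i → FreeTiles.P? 𝒫 k (j , i)) (allFin (suc (toℕ j))))

{-# OPTIONS --safe #-}
module Submission where

-- Let F₀ be cut out of GT(λ,μ) by the equations y a = y b for the adjacent pairs
-- with x a = x b.  These inequalities are the only ones tight at x: an entry 0 of x
-- forces zeros along its diagonal up to the fixed top row, so nonnegativity adds no
-- further condition.  Hence x can be moved a little in both directions along every w
-- which is constant on tiles, zero on the top and bottom rows and of zero row sums;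
-- so F₀ lies in every face through x, and the direction space of F₀ consists of
-- exactly these w.  Such w are the combinations Σ vₖ 1_{Pₖ} of the indicators of the
-- free tiles with v in the kernel of the tiling matrix.

open import Defs
open import Algebra.Module.Morphism.Structures using (module LeftModuleMorphisms)
import Algebra.Properties.CommutativeSemigroup as CommutativeSemigroupProperties
import Algebra.Properties.Ring as RingProperties
import Algebra.Properties.Semiring.Sum as SumProperties
open import Data.Bool.Base using (if_then_else_)
open import Data.Fin.Base using (Fin; zero; suc; toℕ; fromℕ<; inject₁; punchIn)
open import Data.Fin.Induction using (<-weakInduction)
import Data.Fin.Properties as Fin
open import Data.Integer.Base using (ℤ)
open import Data.List.Base as List using (List; []; _∷_)
open import Data.List.Membership.Propositional using (lose) renaming (_∈_ to _∈ˡ_)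
open import Data.List.Membership.Propositional.Properties
  using (∈-concatMap⁺; ∈-map⁺; ∈-allFin; ∈-cartesianProduct⁺)
open import Data.List.Relation.Unary.All as All using (All; []; _∷_)
open import Data.Nat.Base as ℕ using (ℕ; zero; suc; s≤s; z≤n)
import Data.Nat.Properties as ℕ
open import Data.Product.Base using (∃-syntax; _×_; _,_; proj₁; proj₂)
open import Data.Sum.Base using (_⊎_; inj₁; inj₂)
open import Data.Unit.Base using (⊤; tt)
open import Data.Vec.Base as Vec using (count; tabulate)
open import Data.Vec.Functional using (Vector; insertAt; removeAt)
open import Data.Vec.Functional.Properties using (insertAt-lookup; insertAt-punchIn)
open import Function.Base using (_∘_; id)
open import Level using (0ℓ)
open import Relation.Binary.Construct.Closure.ReflexiveTransitive as Star using (_◅_; _◅◅_)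
open import Relation.Binary.PropositionalEquality as ≡ using (_≡_; _≢_)
import Relation.Binary.Reasoning.Setoid as SetoidReasoning
open import Relation.Binary.Structures using (module IsDecTotalOrder)
open import Relation.Nullary.Decidable using (Dec; yes; no; does; ¬?; decidable-stable; _×-dec_)
open import Relation.Nullary.Negation using (¬_; contradiction)
open import Relation.Unary using (Pred; Decidable; _∈_; _⊆_; _≐_)

module _ (ℝ : RealField) where

  open RealField ℝ hiding (zero)
  open GelfandTsetlin ℝ
  open IsDecTotalOrder isDecTotalOrder
    using (_≟_; total; antisym; ≤-respˡ-≈; ≤-respʳ-≈)
    renaming (refl to ≤-refl; trans to ≤-trans; reflexive to ≤-reflexive)
  open RingProperties ring
    using ( -‿distribˡ-*; -‿involutive; -1*x≈-x; +-cancelʳ; x[y-z]≈xy-xz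
          ; xyx⁻¹≈y; x∙y⁻¹≈ε⇒x≈y; x≈y⇒x∙y⁻¹≈ε; //-rightDividesˡ; -‿+-comm)
  open SumProperties semiring
    using ( sum; sum-cong-≋; sum-replicate-zero; sum-remove; ∑-comm; ∑-distrib-+
          ; *-distribˡ-sum; *-distribʳ-sum)
  open CommutativeSemigroupProperties +-commutativeSemigroup using (interchange)
  open SetoidReasoning setoid

  -- Ordered field arithmetic

  y+[x-y]≈x : ∀ x y → y + (x - y) ≈ x
  y+[x-y]≈x x y = trans (+-comm y _) (//-rightDividesˡ y x)

  +-monoʳ-≤ : ∀ {a b} c → a ≤ b → c + a ≤ c + b
  +-monoʳ-≤ c a≤b = ≤-respˡ-≈ (+-comm _ c) (≤-respʳ-≈ (+-comm _ c) (+-monoˡ-≤ c a≤b))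

  x≤y⇒0≤y-x : ∀ {x y} → x ≤ y → 0# ≤ y - x
  x≤y⇒0≤y-x {x} x≤y = ≤-respˡ-≈ (-‿inverseʳ x) (+-monoˡ-≤ (- x) x≤y)

  x≤y⇒x-y≤0 : ∀ {x y} → x ≤ y → x - y ≤ 0#
  x≤y⇒x-y≤0 {_} {y} x≤y = ≤-respʳ-≈ (-‿inverseʳ y) (+-monoˡ-≤ (- y) x≤y)

  0≤y-x⇒x≤y : ∀ {x y} → 0# ≤ y - x → x ≤ y
  0≤y-x⇒x≤y {x} {y} 0≤y-x =
    ≤-respˡ-≈ (+-identityˡ x) (≤-respʳ-≈ (//-rightDividesˡ x y) (+-monoˡ-≤ x 0≤y-x))

  *-monoˡ-≤ : ∀ {a b} c → 0# ≤ c → a ≤ b → c * a ≤ c * b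
  *-monoˡ-≤ c 0≤c a≤b =
    0≤y-x⇒x≤y (≤-respʳ-≈ (x[y-z]≈xy-xz c _ _) (*-nonNeg 0≤c (x≤y⇒0≤y-x a≤b)))

  *-monoʳ-≤ : ∀ {a b} c → 0# ≤ c → a ≤ b → a * c ≤ b * c
  *-monoʳ-≤ c 0≤c a≤b =
    ≤-respˡ-≈ (*-comm c _) (≤-respʳ-≈ (*-comm c _) (*-monoˡ-≤ c 0≤c a≤b))

  -- If 1 ≤ 0 then -1 is nonnegative, hence so is its square, which is 1.
  0≤1 : 0# ≤ 1#
  0≤1 with total 0# 1#
  ... | inj₁ 0≤1 = 0≤1
  ... | inj₂ 1≤0 = ≤-respʳ-≈ -1*-1≈1 (*-nonNeg 0≤-1 0≤-1)
    where
    0≤-1 : 0# ≤ - 1#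
    0≤-1 = ≤-respʳ-≈ (+-identityˡ _) (x≤y⇒0≤y-x 1≤0)
    -1*-1≈1 : - 1# * - 1# ≈ 1#
    -1*-1≈1 = trans (-1*x≈-x (- 1#)) (-‿involutive 1#)

  *-cancelˡ-0 : ∀ {a b} → ¬ (a ≈ 0#) → a * b ≈ 0# → b ≈ 0#
  *-cancelˡ-0 {a} {b} a≉0 ab≈0 with a⁻¹ , aa⁻¹≈1 ← inverse a a≉0 = begin
    b              ≈⟨ *-identityˡ b ⟨
    1# * b         ≈⟨ *-congʳ (trans (*-comm a⁻¹ a) aa⁻¹≈1) ⟨
    a⁻¹ * a * b    ≈⟨ *-assoc a⁻¹ a b ⟩
    a⁻¹ * (a * b)  ≈⟨ *-congˡ ab≈0 ⟩
    a⁻¹ * 0#       ≈⟨ zeroʳ a⁻¹ ⟩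
    0#             ∎

  inverse-nonNeg : ∀ {a b} → 0# ≤ a → a * b ≈ 1# → 0# ≤ b
  inverse-nonNeg {a} {b} 0≤a ab≈1 with total 0# b
  ... | inj₁ 0≤b = 0≤b
  ... | inj₂ b≤0 = contradiction (antisym 0≤1 1≤0) 0≉1
    where
    1≤0 : 1# ≤ 0#
    1≤0 = ≤-respˡ-≈ ab≈1 (≤-respʳ-≈ (zeroʳ a) (*-monoˡ-≤ a 0≤a b≤0))

  Positive : Pred Carrier 0ℓ
  Positive ε = 0# ≤ ε × ¬ (ε ≈ 0#)

  1-positive : Positive 1#
  1-positive = 0≤1 , 0≉1 ∘ sym

  -- A strict inequality survives a small change of both sides, and an equality survives because
  -- both sides change by the same amount.
  perturb-≤ : ∀ {p q} r s → p ≤ q → (p ≈ q → r ≈ s) →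
              ∃[ ε₀ ] Positive ε₀ × (∀ {ε} → 0# ≤ ε → ε ≤ ε₀ → p + ε * r ≤ q + ε * s)
  perturb-≤ {p} {q} r s p≤q tight with p ≟ q | total r s
  ... | yes p≈q | _ = 1# , 1-positive , λ _ _ → ≤-reflexive (+-cong p≈q (*-congˡ (tight p≈q)))
  ... | no _ | inj₁ r≤s = 1# , 1-positive , λ {ε} 0≤ε _ →
    ≤-trans (+-monoˡ-≤ (ε * r) p≤q) (+-monoʳ-≤ q (*-monoˡ-≤ ε 0≤ε r≤s))
  ... | no p≉q | inj₂ s≤r with (r - s) ≟ 0#
  ...   | yes r-s≈0 = 1# , 1-positive , λ {ε} _ _ →
    ≤-respʳ-≈ (+-congˡ (*-congˡ (x∙y⁻¹≈ε⇒x≈y r s r-s≈0))) (+-monoˡ-≤ (ε * r) p≤q)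
  ...   | no r-s≉0 with t⁻¹ , tt⁻¹≈1 ← inverse (r - s) r-s≉0 =
    -- Here `r` exceeds `s`, and the threshold `(q - p) / (r - s)` is the value of ε at which the
    -- two sides meet.
    (q - p) * t⁻¹ , (*-nonNeg 0≤q-p (inverse-nonNeg 0≤r-s tt⁻¹≈1) , ε₀≉0) , bound
    where
    t = r - s
    0≤q-p = x≤y⇒0≤y-x p≤q
    0≤r-s = x≤y⇒0≤y-x s≤r
    ε₀t≈q-p : (q - p) * t⁻¹ * t ≈ q - p
    ε₀t≈q-p = trans (*-assoc _ _ _)
      (trans (*-congˡ (trans (*-comm t⁻¹ t) tt⁻¹≈1)) (*-identityʳ _))
    ε₀≉0 : ¬ ((q - p) * t⁻¹ ≈ 0#)
    ε₀≉0 ε₀≈0 = p≉q (sym (x∙y⁻¹≈ε⇒x≈y q p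
      (trans (sym ε₀t≈q-p) (trans (*-congʳ ε₀≈0) (zeroˡ t)))))
    bound : ∀ {ε} → 0# ≤ ε → ε ≤ (q - p) * t⁻¹ → p + ε * r ≤ q + ε * s
    bound {ε} 0≤ε ε≤ε₀ = ≤-respˡ-≈ lhs (≤-respʳ-≈ rhs
      (+-monoˡ-≤ (ε * s) (+-monoʳ-≤ p (≤-respʳ-≈ ε₀t≈q-p (*-monoʳ-≤ t 0≤r-s ε≤ε₀)))))
      where
      lhs : p + ε * t + ε * s ≈ p + ε * r
      lhs = begin
        p + ε * t + ε * s    ≈⟨ +-assoc _ _ _ ⟩
        p + (ε * t + ε * s)  ≈⟨ +-congˡ (distribˡ ε t s) ⟨
        p + ε * (t + s)      ≈⟨ +-congˡ (*-congˡ (//-rightDividesˡ s r)) ⟩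
        p + ε * r            ∎
      rhs : p + (q - p) + ε * s ≈ q + ε * s
      rhs = +-congʳ (y+[x-y]≈x q p)

  -- The smaller of two thresholds serves for both, because each condition holds on the whole
  -- interval from 0 to its threshold.
  common-ε : ∀ {I : Set} (Q : I → Pred Carrier 0ℓ) →
             (∀ i → ∃[ ε₀ ] Positive ε₀ × (∀ {ε} → 0# ≤ ε → ε ≤ ε₀ → Q i ε)) →
             ∀ l → ∃[ ε₀ ] Positive ε₀ × (∀ {ε} → 0# ≤ ε → ε ≤ ε₀ → All (λ i → Q i ε) l)
  common-ε Q small [] = 1# , 1-positive , λ _ _ → []
  common-ε Q small (i ∷ l) with ε₁ , pos₁ , q₁ ← small i | ε₂ , pos₂ , q₂ ← common-ε Q small l
    with total ε₁ ε₂
  ... | inj₁ ε₁≤ε₂ = ε₁ , pos₁ , λ 0≤ε ε≤ε₁ → q₁ 0≤ε ε≤ε₁ ∷ q₂ 0≤ε (≤-trans ε≤ε₁ ε₁≤ε₂)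
  ... | inj₂ ε₂≤ε₁ = ε₂ , pos₂ , λ 0≤ε ε≤ε₂ → q₁ 0≤ε (≤-trans ε≤ε₂ ε₂≤ε₁) ∷ q₂ 0≤ε ε≤ε₂

  -- Linear functionals

  module LinearFunctional {I : Set} {g : (I → Carrier) → Carrier} (lin : IsLinearFunctional g) where
    open LeftModuleMorphisms.IsLeftModuleHomomorphism lin public
      using (⟦⟧-cong; +ᴹ-homo; -ᴹ-homo; 0ᴹ-homo; *ₗ-homo)

    combination-homo : ∀ {m} c (p : Vector (I → Carrier) m) →
                       g (combination c p) ≈ sum (λ k → c k * g (p k))
    combination-homo {zero}  c p = 0ᴹ-homo
    combination-homo {suc m} c p = begin
      g (combination c p)
        ≈⟨ +ᴹ-homo _ _ ⟩
      g (λ a → c zero * p zero a) + g (combination (c ∘ suc) (p ∘ suc))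
        ≈⟨ +-cong (*ₗ-homo _ _) (combination-homo (c ∘ suc) (p ∘ suc)) ⟩
      c zero * g (p zero) + sum (λ k → c (suc k) * g (p (suc k)))
        ∎

  -- Preservation of zero and of negation follows from homogeneity with the scalars 0 and -1.
  isLinearFunctional : ∀ {I : Set} {g : (I → Carrier) → Carrier} →
    (∀ {u v} → (∀ a → u a ≈ v a) → g u ≈ g v) →
    (∀ u v → g (λ a → u a + v a) ≈ g u + g v) →
    (∀ r v → g (λ a → r * v a) ≈ r * g v) →
    IsLinearFunctional g
  isLinearFunctional {g = g} g-cong g-+ g-* = record
    { +ᴹ-isGroupHomomorphism = record
      { isMonoidHomomorphism = record
        { isMagmaHomomorphism = record
          { isRelHomomorphism = record { cong = g-cong }
          ; homo = g-+
          }
        ; ε-homo = trans (g-cong (λ _ → sym (zeroˡ 0#))) (trans (g-* 0# (λ _ → 0#)) (zeroˡ _))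
        }
      ; ⁻¹-homo = λ v → trans (g-cong (λ a → sym (-1*x≈-x (v a)))) (trans (g-* (- 1#) v) (-1*x≈-x (g v)))
      }
    ; *ₗ-homo = g-*
    }

  module _ {I : Set} where

    linear-eval : ∀ a → IsLinearFunctional {I} (λ v → v a)
    linear-eval a = isLinearFunctional (λ u≈v → u≈v a) (λ _ _ → refl) (λ _ _ → refl)

    linear-0 : IsLinearFunctional {I} (λ _ → 0#)
    linear-0 = isLinearFunctional (λ _ → refl) (λ _ _ → sym (+-identityˡ 0#)) (λ r _ → sym (zeroʳ r))

    linear-+ : ∀ {f g} → IsLinearFunctional {I} f → IsLinearFunctional g →
               IsLinearFunctional (λ v → f v + g v)
    linear-+ {f} {g} lf lg = isLinearFunctional
      (λ u≈v → +-cong (F.⟦⟧-cong u≈v) (G.⟦⟧-cong u≈v))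
      (λ u v → trans (+-cong (F.+ᴹ-homo u v) (G.+ᴹ-homo u v)) (interchange _ _ _ _))
      (λ r v → trans (+-cong (F.*ₗ-homo r v) (G.*ₗ-homo r v)) (sym (distribˡ r _ _)))
      where
      module F = LinearFunctional lf
      module G = LinearFunctional lg

    linear-difference : ∀ a b → IsLinearFunctional {I} (λ v → v a - v b)
    linear-difference a b = isLinearFunctional
      (λ u≈v → +-cong (u≈v a) (-‿cong (u≈v b)))
      (λ u v → trans (+-congˡ (sym (-‿+-comm _ _))) (interchange _ _ _ _))
      (λ r v → sym (x[y-z]≈xy-xz r _ _))

    linear-combination : ∀ {m} (b : Vector (I → Carrier) m) a →
                         IsLinearFunctional (λ c → combination c b a)
    linear-combination b a = isLinearFunctional
      (λ u≈v → sum-cong-≋ (λ k → *-congʳ (u≈v k)))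
      (λ u v → trans (sum-cong-≋ (λ k → distribʳ (b k a) (u k) (v k)))
                     (∑-distrib-+ (λ k → u k * b k a) (λ k → v k * b k a)))
      (λ r v → trans (sum-cong-≋ (λ k → *-assoc r (v k) (b k a)))
                     (sym (*-distribˡ-sum r (λ k → v k * b k a))))

    linear-sum : ∀ {m} {f : Fin m → (I → Carrier) → Carrier} →
                 (∀ k → IsLinearFunctional (f k)) → IsLinearFunctional (λ v → sum (λ k → f k v))
    linear-sum {zero}  lf = linear-0
    linear-sum {suc m} lf = linear-+ (lf zero) (linear-sum (lf ∘ suc))

  -- Dimension

  sum-zero : ∀ {m} {t : Vector Carrier m} → (∀ k → t k ≈ 0#) → sum t ≈ 0#
  sum-zero {m} t≈0 = trans (sum-cong-≋ t≈0) (sum-replicate-zero m)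

  sum-single : ∀ {m} (t : Vector Carrier m) k → (∀ l → l ≢ k → t l ≈ 0#) → sum t ≈ t k
  sum-single t zero    t≈0 = trans (+-congˡ (sum-zero (λ l → t≈0 (suc l) λ ()))) (+-identityʳ _)
  sum-single t (suc k) t≈0 = trans (+-cong (t≈0 zero λ ()) (sum-single (t ∘ suc) k
    (λ l l≢k → t≈0 (suc l) (l≢k ∘ Fin.suc-injective)))) (+-identityˡ _)

  indicator : ∀ {A : Set} → Dec A → Carrier
  indicator a? = if does a? then 1# else 0#

  indicator-yes : ∀ {A : Set} (a? : Dec A) → A → indicator a? ≈ 1#
  indicator-yes (yes _) _ = refl
  indicator-yes (no ¬a) a = contradiction a ¬a

  indicator-no : ∀ {A : Set} (a? : Dec A) → ¬ A → indicator a? ≈ 0#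
  indicator-no (yes a) ¬a = contradiction a ¬a
  indicator-no (no _)  _  = refl

  *-cancelʳ-nonZero : ∀ {a} x y → ¬ (a ≈ 0#) → x * a ≈ y * a → x ≈ y
  *-cancelʳ-nonZero {a} x y a≉0 xa≈ya = x∙y⁻¹≈ε⇒x≈y x y (*-cancelˡ-0 a≉0 (begin
    a * (x - y)    ≈⟨ x[y-z]≈xy-xz a x y ⟩
    a * x - a * y  ≈⟨ x≈y⇒x∙y⁻¹≈ε (trans (*-comm a x) (trans xa≈ya (*-comm y a))) ⟩
    0#             ∎))

  module _ {I : Set} where

    -- The form `u + r v` is the operation performed by an elimination step.
    Closed : Pred (Pred (I → Carrier) 0ℓ) 0ℓ
    Closed W = ∀ {u v} r → u ∈ W → v ∈ W → (λ a → u a + r * v a) ∈ W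

    solutions-closed : ∀ {m} {g : Fin m → (I → Carrier) → Carrier} → (∀ l → IsLinearFunctional (g l)) →
                       Closed (λ v → ∀ l → g l v ≈ 0#)
    solutions-closed lin r u∈ v∈ l = begin
      _            ≈⟨ trans (G.+ᴹ-homo _ _) (+-congˡ (G.*ₗ-homo r _)) ⟩
      _ + r * _    ≈⟨ +-cong (u∈ l) (*-congˡ (v∈ l)) ⟩
      0# + r * 0#  ≈⟨ trans (+-identityˡ _) (zeroʳ r) ⟩
      0#           ∎
      where module G = LinearFunctional (lin l)

    HasDimension-resp-≐ : ∀ {U W : Pred (I → Carrier) 0ℓ} {d} → U ≐ W → HasDimension U d → HasDimension W d
    HasDimension-resp-≐ (U⊆W , W⊆U) (b , b∈U , indep , span) =
      b , (λ k → U⊆W (b∈U k)) , indep , λ w∈W → span (W⊆U w∈W)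

    -- One step of Gaussian elimination: the basis vector b k with g (b k) ≉ 0 is
    -- used to make g vanish on the others, and is then dropped.
    eliminate : ∀ {W : Pred (I → Carrier) 0ℓ} {d g} → Closed W → IsLinearFunctional g →
                ((b , _) : HasDimension W (suc d)) → ∀ k → ¬ (g (b k) ≈ 0#) →
                HasDimension (λ v → v ∈ W × g v ≈ 0#) d
    eliminate {W} {d} {g} closed lin (b , b∈W , indep , span) k p≉0
      with q , pq≈1 ← inverse (g (b k)) p≉0 =
      b′ , (λ i → closed (t i) (b∈W (punchIn k i)) (b∈W k) , gb′≈0 i) , indep′ , span′
      where
      module G = LinearFunctional lin
      p = g (b k)

      t : Vector Carrier d
      t i = - (g (b (punchIn k i)) * q)

      b′ : Vector (I → Carrier) d
      b′ i a = b (punchIn k i) a + t i * b k a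

      gb′≈0 : ∀ i → g (b′ i) ≈ 0#
      gb′≈0 i = begin
        g (b′ i)               ≈⟨ trans (G.+ᴹ-homo _ _) (+-congˡ (G.*ₗ-homo _ _)) ⟩
        x + - (x * q) * p      ≈⟨ +-congˡ (-‿distribˡ-* (x * q) p) ⟨
        x + - (x * q * p)      ≈⟨ +-congˡ (-‿cong (trans (*-assoc x q p)
                                    (trans (*-congˡ (trans (*-comm q p) pq≈1)) (*-identityʳ x)))) ⟩
        x - x                  ≈⟨ -‿inverseʳ x ⟩
        0#                     ∎
        where x = g (b (punchIn k i))

      -- Stated for arbitrary scalars `β`, since it is applied both to the coordinates of the basis
      -- vectors at a point and to their values under `g`.
      regroup : ∀ (c : Vector Carrier d) (β : Vector Carrier (suc d)) →
                sum (λ i → c i * (β (punchIn k i) + t i * β k)) ≈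
                sum (λ i → c i * t i) * β k + sum (λ i → c i * β (punchIn k i))
      regroup c β = begin
        sum (λ i → c i * (β (punchIn k i) + t i * β k))
          ≈⟨ sum-cong-≋ (λ i → trans (distribˡ (c i) _ _)
               (trans (+-comm _ _) (+-congʳ (sym (*-assoc _ _ _))))) ⟩
        sum (λ i → c i * t i * β k + c i * β (punchIn k i))
          ≈⟨ ∑-distrib-+ (λ i → c i * t i * β k) (λ i → c i * β (punchIn k i)) ⟩
        sum (λ i → c i * t i * β k) + sum (λ i → c i * β (punchIn k i))
          ≈⟨ +-congʳ (*-distribʳ-sum (β k) (λ i → c i * t i)) ⟨
        sum (λ i → c i * t i) * β k + sum (λ i → c i * β (punchIn k i))
          ∎

      indep′ : LinearlyIndependent b′
      indep′ c comb≈0 i = trans (reflexive (≡.sym (insertAt-punchIn c k u i))) (indep c⁺ comb⁺≈0 (punchIn k i))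
        where
        -- Expanding a relation among the `b′` gives a relation among the `b` in which `b k` has
        -- this coefficient.
        u = sum (λ i → c i * t i)
        c⁺ = insertAt c k u
        comb⁺≈0 : ∀ a → combination c⁺ b a ≈ 0#
        comb⁺≈0 a = begin
          combination c⁺ b a
            ≈⟨ sum-remove {i = k} (λ l → c⁺ l * b l a) ⟩
          c⁺ k * b k a + sum (λ i → c⁺ (punchIn k i) * b (punchIn k i) a)
            ≈⟨ +-cong (*-congʳ (reflexive (insertAt-lookup c k u)))
                 (sum-cong-≋ (λ i → *-congʳ (reflexive (insertAt-punchIn c k u i)))) ⟩
          u * b k a + sum (λ i → c i * b (punchIn k i) a)
            ≈⟨ regroup c (λ l → b l a) ⟨
          combination c b′ a
            ≈⟨ comb≈0 a ⟩
          0#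
            ∎

      span′ : ∀ {w} → w ∈ W × g w ≈ 0# → ∃[ c ] (∀ a → w a ≈ combination c b′ a)
      span′ {w} (w∈W , gw≈0) with c , w≈ ← span w∈W = removeAt c k , λ a → begin
        w a
          ≈⟨ w≈ a ⟩
        combination c b a
          ≈⟨ sum-remove {i = k} (λ l → c l * b l a) ⟩
        c k * b k a + sum (λ i → c (punchIn k i) * b (punchIn k i) a)
          ≈⟨ +-congʳ (*-congʳ (ck≈ c w≈)) ⟩
        _
          ≈⟨ regroup (removeAt c k) (λ l → b l a) ⟨
        combination (removeAt c k) b′ a
          ∎
        where
        -- Applying `g` determines the coefficient of `b k`: both `g w` and the combination of the
        -- values `g (b′ i)` vanish, and comparing them allows `p` to be cancelled.
        ck≈ : ∀ c → (∀ a → w a ≈ combination c b a) → c k ≈ sum (λ i → c (punchIn k i) * t i)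
        ck≈ c w≈ = *-cancelʳ-nonZero _ _ p≉0 (+-cancelʳ _ _ _ (begin
          c k * p + sum (λ i → c (punchIn k i) * g (b (punchIn k i)))
            ≈⟨ sum-remove {i = k} (λ l → c l * g (b l)) ⟨
          sum (λ l → c l * g (b l))
            ≈⟨ G.combination-homo c b ⟨
          g (combination c b)
            ≈⟨ trans (sym (G.⟦⟧-cong w≈)) gw≈0 ⟩
          0#
            ≈⟨ sum-zero (λ i → trans (*-congˡ (trans
                 (sym (trans (G.+ᴹ-homo _ _) (+-congˡ (G.*ₗ-homo _ _)))) (gb′≈0 i))) (zeroʳ _)) ⟨
          sum (λ i → c (punchIn k i) * (g (b (punchIn k i)) + t i * p))
            ≈⟨ regroup (removeAt c k) (g ∘ b) ⟩
          sum (λ i → c (punchIn k i) * t i) * p + sum (λ i → c (punchIn k i) * g (b (punchIn k i)))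
            ∎))

    -- Either `g` is nonzero on some basis vector, which is then eliminated, or it vanishes on all
    -- of them and the basis remains valid.
    hyperplane-dimension : ∀ {W : Pred (I → Carrier) 0ℓ} {d g} → Closed W → IsLinearFunctional g →
      HasDimension W d → ∃[ d′ ] HasDimension (λ v → v ∈ W × g v ≈ 0#) d′ × d ℕ.≤ suc d′
    hyperplane-dimension {g = g} closed lin (b , b∈W , indep , span)
      with Fin.any? (λ k → ¬? (g (b k) ≟ 0#))
    hyperplane-dimension {d = zero}  closed lin basis | yes (() , _)
    hyperplane-dimension {d = suc d} closed lin basis | yes (k , p≉0) =
      d , eliminate closed lin basis k p≉0 , ℕ.≤-refl
    hyperplane-dimension {d = d} {g} closed lin (b , b∈W , indep , span) | no ∄p =
      d , (b , (λ k → b∈W k , decidable-stable (g (b k) ≟ 0#) (λ p≉0 → ∄p (k , p≉0)))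
             , indep , λ w∈ → span (proj₁ w∈))
        , ℕ.n≤1+n d

  full-dimension : ∀ s → HasDimension {Fin s} (λ _ → ⊤) s
  full-dimension s = δ , (λ _ → tt) , indep , λ {w} _ → w , λ a → sym (combination-δ w a)
    where
    δ : Vector (Fin s → Carrier) s
    δ k a = indicator (k Fin.≟ a)
    combination-δ : ∀ c a → combination c δ a ≈ c a
    combination-δ c a = trans
      (sum-single (λ k → c k * δ k a) a (λ l l≢a → trans (*-congˡ (indicator-no (l Fin.≟ a) l≢a)) (zeroʳ _)))
      (trans (*-congˡ (indicator-yes (a Fin.≟ a) ≡.refl)) (*-identityʳ _))
    indep : LinearlyIndependent δ
    indep c comb≈0 k = trans (sym (combination-δ c k)) (comb≈0 k)

  -- Each equation lowers the dimension by at most one, starting from the full space. This yields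
  -- both the existence of a basis of a kernel and the lower bound on its size used to compare
  -- dimensions.
  solution-dimension : ∀ {s m} (g : Fin m → (Fin s → Carrier) → Carrier) → (∀ l → IsLinearFunctional (g l)) →
                       ∃[ d ] HasDimension (λ v → ∀ l → g l v ≈ 0#) d × s ℕ.≤ m ℕ.+ d
  solution-dimension {s} {zero} g lin =
    s , HasDimension-resp-≐ ((λ _ ()) , (λ _ → tt)) (full-dimension s) , ℕ.≤-refl
  solution-dimension {s} {suc m} g lin
    with d , dim , s≤m+d ← solution-dimension (g ∘ suc) (lin ∘ suc)
    with d′ , dim′ , d≤1+d′ ← hyperplane-dimension (solutions-closed (lin ∘ suc)) (lin zero) dim =
    d′ , HasDimension-resp-≐ (cons , λ v∈ → v∈ ∘ suc , v∈ zero) dim′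
       , ℕ.≤-trans s≤m+d (ℕ.≤-trans (ℕ.+-monoʳ-≤ m d≤1+d′) (ℕ.≤-reflexive (ℕ.+-suc m d′)))
    where
    cons : ∀ {v} → (∀ l → g (suc l) v ≈ 0#) × g zero v ≈ 0# → ∀ l → g l v ≈ 0#
    cons (_  , v∈) zero    = v∈
    cons (v∈ , _)  (suc l) = v∈ l

  -- Comparison of dimensions

  module _ {I : Set} where

    -- This is associativity of the matrix product, obtained from linearity of a combination in its
    -- coefficients.
    combination-assoc : ∀ {m n} (c : Vector Carrier m) (M : Vector (Fin n → Carrier) m)
                        (b : Vector (I → Carrier) n) a →
                        combination (combination c M) b a ≈ combination c (λ k → combination (M k) b) a
    combination-assoc c M b a = LinearFunctional.combination-homo (linear-combination b a) c M

    combination-congˡ : ∀ {m} {c d : Vector Carrier m} (b : Vector (I → Carrier) m) a →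
                        (∀ k → c k ≈ d k) → combination c b a ≈ combination d b a
    combination-congˡ b a = LinearFunctional.⟦⟧-cong (linear-combination b a)

    -- The matrix `M` expresses the basis `u` through `w`. Independence of `u` leaves only the zero
    -- solution of `c M = 0`, while there is a solution space of dimension at least `d - e`.
    dimension-mono : ∀ {U W : Pred (I → Carrier) 0ℓ} {d e} → U ⊆ W →
                     HasDimension U d → HasDimension W e → d ℕ.≤ e
    dimension-mono {d = d} {e} U⊆W (u , u∈U , indep , _) (w , _ , _ , span) = go solutions
      where
      M : Vector (Fin e → Carrier) d
      M k = proj₁ (span (U⊆W (u∈U k)))
      solutions : ∃[ d′ ] HasDimension (λ c → ∀ l → combination c M l ≈ 0#) d′ × d ℕ.≤ e ℕ.+ d′
      solutions = solution-dimension (λ l c → combination c M l) (linear-combination M)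
      trivial : ∀ {c} → (∀ l → combination c M l ≈ 0#) → ∀ k → c k ≈ 0#
      trivial {c} cM≈0 = indep c λ a → begin
        combination c u a                             ≈⟨ sum-cong-≋ (λ k → *-congˡ (proj₂ (span (U⊆W (u∈U k))) a)) ⟩
        combination c (λ k → combination (M k) w) a   ≈⟨ combination-assoc c M w a ⟨
        combination (combination c M) w a             ≈⟨ sum-zero (λ l → trans (*-congʳ (cM≈0 l)) (zeroˡ _)) ⟩
        0#                                            ∎
      go : ∃[ d′ ] HasDimension (λ c → ∀ l → combination c M l ≈ 0#) d′ × d ℕ.≤ e ℕ.+ d′ → d ℕ.≤ e
      go (zero   , _ , d≤e+0) = ≡.subst (d ℕ.≤_) (ℕ.+-identityʳ e) d≤e+0
      -- All solutions being zero, the sum of the alleged basis vectors is zero, and independence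
      -- would give 1 = 0.
      go (suc d′ , (b , b∈ , indep′ , _) , _) = contradiction
        (sym (indep′ (λ _ → 1#) (λ k → sum-zero (λ l → trans (*-congˡ {1#} (trivial (b∈ l) k)) (zeroʳ 1#))) zero)) 0≉1

    -- Independence of `b` makes `v ↦ combination v b` injective, so this map carries a basis of `K`
    -- to a basis of `W`.
    image-dimension : ∀ {s d} {K : Pred (Fin s → Carrier) 0ℓ} {W : Pred (I → Carrier) 0ℓ}
      (b : Vector (I → Carrier) s) → LinearlyIndependent b →
      (∀ {v} → v ∈ K → combination v b ∈ W) →
      (∀ {w} → w ∈ W → ∃[ v ] v ∈ K × (∀ a → w a ≈ combination v b a)) →
      HasDimension K d → HasDimension W d
    image-dimension b indep image preimage (β , β∈K , β-indep , β-span) =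
      (λ k → combination (β k) b) , (λ k → image (β∈K k)) ,
      (λ c comb≈0 → β-indep c (indep _ (λ a → trans (combination-assoc c β b a) (comb≈0 a)))) ,
      λ w∈W → let v , v∈K , w≈ = preimage w∈W ; c , v≈ = β-span v∈K in
        c , λ a → trans (w≈ a) (trans (combination-congˡ b a v≈) (combination-assoc c β b a))

  -- Affine hulls and faces

  module _ {I : Set} where

    affineHull-const : ∀ {S : Pred (I → Carrier) 0ℓ} {f r} → IsLinearFunctional f → (∀ {p} → p ∈ S → f p ≈ r) →
                       ∀ {y} → y ∈ affineHull S → f y ≈ r
    affineHull-const {f = f} {r} lin const {y} (m , c , p , p∈S , ∑c≈1 , y≈) = begin
      f y                        ≈⟨ F.⟦⟧-cong y≈ ⟩
      f (combination c p)        ≈⟨ F.combination-homo c p ⟩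
      sum (λ k → c k * f (p k))  ≈⟨ sum-cong-≋ (λ k → *-congˡ (const (p∈S k))) ⟩
      sum (λ k → c k * r)        ≈⟨ *-distribʳ-sum r c ⟨
      sum c * r                  ≈⟨ trans (*-congʳ ∑c≈1) (*-identityˡ r) ⟩
      r                          ∎
      where module F = LinearFunctional lin

    -- A functional constant on `S` is constant on its affine hull, because the coefficients sum to
    -- 1, and so vanishes on differences. Equations of a face thus become homogeneous equations of
    -- its direction space.
    direction-vanish : ∀ {S : Pred (I → Carrier) 0ℓ} {f r} → IsLinearFunctional f → (∀ {p} → p ∈ S → f p ≈ r) →
                       ∀ {v} → v ∈ direction (affineHull S) → f v ≈ 0#
    direction-vanish {f = f} {r} lin const {v} (a , b , a∈ , b∈ , v≈) = begin
      f v        ≈⟨ F.⟦⟧-cong v≈ ⟩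
      f _        ≈⟨ trans (F.+ᴹ-homo _ _) (+-congˡ (F.-ᴹ-homo b)) ⟩
      f a - f b  ≈⟨ x≈y⇒x∙y⁻¹≈ε (trans (affineHull-const lin const a∈) (sym (affineHull-const lin const b∈))) ⟩
      0#         ∎
      where module F = LinearFunctional lin

    ⊆-affineHull : ∀ (S : Pred (I → Carrier) 0ℓ) → S ⊆ affineHull S
    ⊆-affineHull S {y} y∈S = 1 , (λ _ → 1#) , (λ _ → y) , (λ _ → y∈S) , +-identityʳ 1# ,
      λ a → sym (trans (+-identityʳ _) (*-identityˡ (y a)))

    direction-affineHull-mono : ∀ (S T : Pred (I → Carrier) 0ℓ) → S ⊆ T →
                                direction (affineHull S) ⊆ direction (affineHull T)
    direction-affineHull-mono S T S⊆T (a , b , a∈ , b∈ , v≈) = a , b , mono a∈ , mono b∈ , v≈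
      where
      mono : affineHull S ⊆ affineHull T
      mono (m , c , p , p∈S , rest) = m , c , p , (λ k → S⊆T (p∈S k)) , rest

    -- The sum of the valid inequalities is valid, and equality in the sum forces equality in each
    -- summand.
    ⋂-isFace : ∀ {J : Set} {P : Pred (I → Carrier) 0ℓ} (Q : J → Pred (I → Carrier) 0ℓ) →
               (∀ i → IsFaceOf P (λ y → y ∈ P × Q i y)) →
               ∀ l → IsFaceOf P (λ y → y ∈ P × All (λ i → Q i y) l)
    ⋂-isFace Q face [] = (λ _ → 0#) , 0# , linear-0 , (λ _ → ≤-refl) ,
      (λ (y∈P , _) → y∈P , refl) , (λ (y∈P , _) → y∈P , [])
    ⋂-isFace {P = P} Q face (i ∷ l)
      with f , c , lf , f≤c , F⊆ , ⊆F ← face i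
         | g , d , lg , g≤d , G⊆ , ⊆G ← ⋂-isFace Q face l =
      (λ y → f y + g y) , c + d , linear-+ lf lg ,
      (λ y∈P → ≤-trans (+-monoˡ-≤ _ (f≤c y∈P)) (+-monoʳ-≤ c (g≤d y∈P))) ,
      (λ where (y∈P , q ∷ qs) → y∈P , +-cong (proj₂ (F⊆ (y∈P , q))) (proj₂ (G⊆ (y∈P , qs)))) ,
      (λ (y∈P , f+g≈) → y∈P , proj₂ (⊆F (y∈P , tight (f≤c y∈P) (g≤d y∈P) f+g≈))
                            ∷ proj₂ (⊆G (y∈P , tight (g≤d y∈P) (f≤c y∈P)
                                        (trans (+-comm _ _) (trans f+g≈ (+-comm c d))))))
      where
      tight : ∀ {a b c d} → a ≤ c → b ≤ d → a + b ≈ c + d → a ≈ c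
      tight {a} {b} {c} {d} a≤c b≤d a+b≈c+d = antisym a≤c
        (≤-respˡ-≈ (cancel c) (≤-respʳ-≈ (cancel a)
          (+-monoˡ-≤ (- d) (≤-respˡ-≈ a+b≈c+d (+-monoʳ-≤ a b≤d)))))
        where
        cancel : ∀ x → x + d - d ≈ x
        cancel x = trans (+-assoc x d (- d)) (trans (+-congˡ (-‿inverseʳ d)) (+-identityʳ x))

  IsFaceOf-resp-≐ : ∀ {I : Set} {P F G : Pred (I → Carrier) 0ℓ} → F ≐ G → IsFaceOf P F → IsFaceOf P G
  IsFaceOf-resp-≐ (F⊆G , G⊆F) (f , c , lf , f≤c , F⊆ , ⊆F) =
    f , c , lf , f≤c , (λ y∈G → F⊆ (G⊆F y∈G)) , λ y∈ → F⊆G (⊆F y∈)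

  -- The minimal face

  module _ {n : ℕ} where

    cells : List (Cell n)
    cells = List.concatMap (λ j → List.map (j ,_) (List.allFin (suc (toℕ j)))) (List.allFin n)

    ∈-cells : ∀ a → a ∈ˡ cells
    ∈-cells (j , i) = ∈-concatMap⁺ _ (lose (∈-allFin j) (∈-map⁺ _ (∈-allFin i)))

    cellPairs : List (Cell n × Cell n)
    cellPairs = List.cartesianProduct cells cells

    ∈-cellPairs : ∀ a b → (a , b) ∈ˡ cellPairs
    ∈-cellPairs a b = ∈-cartesianProduct⁺ (∈-cells a) (∈-cells b)

    _⋖_ : Cell n → Cell n → Set
    a ⋖ b = a UpTo b ⊎ a DiagTo b

    _UpTo?_ : ∀ (a b : Cell n) → Dec (a UpTo b)
    a UpTo? b = (col b ℕ.≟ col a) ×-dec (row b ℕ.≟ suc (row a))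

    _DiagTo?_ : ∀ (a b : Cell n) → Dec (a DiagTo b)
    a DiagTo? b = (col b ℕ.≟ suc (col a)) ×-dec (row b ℕ.≟ suc (row a))

    Adjacent-sym : ∀ {a b : Cell n} → Adjacent a b → Adjacent b a
    Adjacent-sym (inj₁ p)               = inj₂ (inj₂ (inj₁ p))
    Adjacent-sym (inj₂ (inj₁ p))        = inj₂ (inj₂ (inj₂ p))
    Adjacent-sym (inj₂ (inj₂ (inj₁ p))) = inj₁ p
    Adjacent-sym (inj₂ (inj₂ (inj₂ p))) = inj₂ (inj₁ p)

    ⋖⇒Adjacent : ∀ {a b : Cell n} → a ⋖ b → Adjacent a b
    ⋖⇒Adjacent (inj₁ up)   = inj₂ (inj₁ up)
    ⋖⇒Adjacent (inj₂ diag) = inj₁ diag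

    row≤n : ∀ (a : Cell n) → row a ℕ.≤ n
    row≤n (j , _) = Fin.toℕ<n j

    diagonal-successor : ∀ (a : Cell n) → row a ℕ.< n → ∃[ b ] a DiagTo b
    diagonal-successor (j , i) j<n = (j⁺ , fromℕ< i⁺<) , ≡.cong suc (Fin.toℕ-fromℕ< i⁺<) , ≡.cong suc j⁺≡
      where
      j⁺ = fromℕ< j<n
      j⁺≡ : toℕ j⁺ ≡ suc (toℕ j)
      j⁺≡ = Fin.toℕ-fromℕ< j<n
      i⁺< : suc (toℕ i) ℕ.< suc (toℕ j⁺)
      i⁺< = s≤s (≡.subst (suc (toℕ i) ℕ.≤_) (≡.sym j⁺≡) (Fin.toℕ<n i))

    -- Entries weakly decrease along a diagonal towards the top row, so each is at least the top
    -- entry of its diagonal.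
    nonNeg-from-top : ∀ {y : X n} → (∀ {a b} → a DiagTo b → y b ≤ y a) →
                      (∀ a → row a ≡ n → 0# ≤ y a) → ∀ a → 0# ≤ y a
    nonNeg-from-top {y} diag top a = go (n ℕ.∸ row a) a (ℕ.m+[n∸m]≡n (row≤n a))
      where
      -- Induction on the number `k` of rows between the cell and the top row.
      go : ∀ k a → row a ℕ.+ k ≡ n → 0# ≤ y a
      go zero    a eq = top a (≡.trans (≡.sym (ℕ.+-identityʳ _)) eq)
      go (suc k) a eq
        with b , a↗b ← diagonal-successor a
               (≡.subst (row a ℕ.<_) eq (ℕ.m<m+n (row a) (s≤s z≤n))) =
        ≤-trans (go k b (≡.trans (≡.cong (ℕ._+ k) (proj₂ a↗b)) (≡.trans (≡.sym (ℕ.+-suc (row a) k)) eq))) (diag a↗b)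

    linear-rowSum : ∀ j → IsLinearFunctional (λ (y : X n) → rowSum y j)
    linear-rowSum j = linear-sum (λ i → linear-eval (j , i))

  module _ {n} {lam μ : Vector ℤ n} {x : X n} (x∈GT : x ∈ GT lam μ) where

    Tight : Cell n → Cell n → Set
    Tight a b = a ⋖ b × x a ≈ x b

    minimalFace : Pred (X n) 0ℓ
    minimalFace y = y ∈ GT lam μ × (∀ {a b} → Tight a b → y a ≈ y b)

    x∈minimalFace : x ∈ minimalFace
    x∈minimalFace = x∈GT , proj₂

    -- As an implication this makes sense for every pair of cells, so the finite list `cellPairs`
    -- can be used without filtering.
    TightEquation : Cell n × Cell n → Pred (X n) 0ℓ
    TightEquation (a , b) y = Tight a b → y a ≈ y b

    -- For a tight pair the functional is the difference of the two entries, signed so that the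
    -- pattern inequality bounds it above by 0. For any other pair the condition is vacuous and the
    -- zero functional gives the whole polytope.
    tightPair-isFace : ∀ ab → IsFaceOf (GT lam μ) (λ y → y ∈ GT lam μ × TightEquation ab y)
    tightPair-isFace (a , b) with x a ≟ x b | a UpTo? b | a DiagTo? b
    ... | yes xa≈xb | yes up | _ = (λ y → y a - y b) , 0# , linear-difference a b ,
      (λ y∈ → x≤y⇒x-y≤0 (IsGTPattern.up (GT.isGTPattern y∈) up)) ,
      (λ (y∈ , tight) → y∈ , x≈y⇒x∙y⁻¹≈ε (tight (inj₁ up , xa≈xb))) ,
      λ (y∈ , eq) → y∈ , λ _ → x∙y⁻¹≈ε⇒x≈y _ _ eq
    ... | yes xa≈xb | no _ | yes diag = (λ y → y b - y a) , 0# , linear-difference b a ,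
      (λ y∈ → x≤y⇒x-y≤0 (IsGTPattern.diag (GT.isGTPattern y∈) diag)) ,
      (λ (y∈ , tight) → y∈ , x≈y⇒x∙y⁻¹≈ε (sym (tight (inj₂ diag , xa≈xb)))) ,
      λ (y∈ , eq) → y∈ , λ _ → sym (x∙y⁻¹≈ε⇒x≈y _ _ eq)
    ... | yes _ | no ¬up | no ¬diag = (λ _ → 0#) , 0# , linear-0 , (λ _ → ≤-refl) ,
      (λ (y∈ , _) → y∈ , refl) ,
      λ (y∈ , _) → y∈ , λ where
        (inj₁ up   , _) → contradiction up ¬up
        (inj₂ diag , _) → contradiction diag ¬diag
    ... | no xa≉xb | _ | _ = (λ _ → 0#) , 0# , linear-0 , (λ _ → ≤-refl) ,
      (λ (y∈ , _) → y∈ , refl) , λ (y∈ , _) → y∈ , λ (_ , xa≈xb) → contradiction xa≈xb xa≉xb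

    minimalFace-isFace : IsFaceOf (GT lam μ) minimalFace
    minimalFace-isFace = IsFaceOf-resp-≐
      ( (λ (y∈ , tight) → y∈ , λ {a} {b} → All.lookup tight (∈-cellPairs a b))
      , (λ (y∈ , tight) → y∈ , All.tabulate λ _ ab → tight ab))
      (⋂-isFace TightEquation tightPair-isFace cellPairs)

    -- The homogeneous linear system belonging to `minimalFace`. The row sums themselves are
    -- required to vanish, not merely their differences, in accordance with `rowSum-fixed`.
    record FaceDirection (w : X n) : Set where
      field
        tight  : ∀ {a b} → Tight a b → w a ≈ w b
        top    : ∀ a → row a ≡ n → w a ≈ 0#
        bottom : ∀ a → row a ≡ 1 → w a ≈ 0#
        weight : ∀ j → rowSum w j ≈ 0#

    top-fixed : ∀ {y} → y ∈ GT lam μ → ∀ a → row a ≡ n → y a ≈ x a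
    top-fixed y∈ a@(j , i) a-top = trans (GT.top y∈ a k a-top col≡) (sym (GT.top x∈GT a k a-top col≡))
      where
      i<n : toℕ i ℕ.< n
      i<n = ℕ.≤-trans (Fin.toℕ<n i) (Fin.toℕ<n j)
      k = fromℕ< i<n
      col≡ : col a ≡ suc (toℕ k)
      col≡ = ≡.cong suc (≡.sym (Fin.toℕ-fromℕ< i<n))

    bottom-fixed : ∀ {y} → y ∈ GT lam μ → ∀ a → row a ≡ 1 → y a ≈ x a
    bottom-fixed y∈ a a-bottom = trans (GT.bottom y∈ a a-bottom) (sym (GT.bottom x∈GT a a-bottom))

  -- The bottom entry is the first row sum, and the weights prescribe the differences of consecutive
  -- ones.
  rowSum-fixed : ∀ {n} {lam μ : Vector ℤ n} {x y : X n} → x ∈ GT lam μ → y ∈ GT lam μ →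
                 ∀ j → rowSum y j ≈ rowSum x j
  rowSum-fixed {suc n} {x = x} {y} x∈ y∈ = <-weakInduction _
    (+-congʳ (bottom-fixed x∈ y∈ (zero , zero) ≡.refl))
    λ i y≈x → begin
      rowSum y (suc i)
        ≈⟨ //-rightDividesˡ (rowSum y (inject₁ i)) _ ⟨
      rowSum y (suc i) - rowSum y (inject₁ i) + rowSum y (inject₁ i)
        ≈⟨ +-cong (trans (GT.weight y∈ _ _ (next i)) (sym (GT.weight x∈ _ _ (next i)))) y≈x ⟩
      rowSum x (suc i) - rowSum x (inject₁ i) + rowSum x (inject₁ i)
        ≈⟨ //-rightDividesˡ (rowSum x (inject₁ i)) _ ⟩
      rowSum x (suc i)
        ∎
    where
    next : ∀ (i : Fin n) → suc (toℕ i) ≡ suc (toℕ (inject₁ i))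
    next i = ≡.cong suc (≡.sym (Fin.toℕ-inject₁ i))

  -- Directions and minimality of the face

  module _ {n} {lam μ : Vector ℤ n} {x : X n} (x∈GT : x ∈ GT lam μ) where

    open GT x∈GT
    open IsGTPattern isGTPattern
    private F₀ = minimalFace x∈GT

    direction⇒FaceDirection : direction (affineHull F₀) ⊆ FaceDirection x∈GT
    direction⇒FaceDirection {w} w∈ = record
      { tight  = λ {a} {b} ab → x∙y⁻¹≈ε⇒x≈y _ _
          (vanish (linear-difference a b) (λ _ tight → x≈y⇒x∙y⁻¹≈ε (tight ab)))
      ; top    = λ a a-top → vanish (linear-eval a) (λ y∈ _ → top-fixed x∈GT y∈ a a-top)
      ; bottom = λ a a-bot → vanish (linear-eval a) (λ y∈ _ → bottom-fixed x∈GT y∈ a a-bot)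
      ; weight = λ j → vanish (linear-rowSum j) (λ y∈ _ → rowSum-fixed x∈GT y∈ j)
      }
      where
      vanish : ∀ {f r} → IsLinearFunctional f →
               (∀ {y} → y ∈ GT lam μ → (∀ {a b} → Tight x∈GT a b → y a ≈ y b) → f y ≈ r) → f w ≈ 0#
      vanish lin const = direction-vanish {S = F₀} lin (λ (y∈ , tight) → const y∈ tight) w∈

    -- There are finitely many pattern inequalities, so one ε serves for all; the prescribed entries
    -- and row sums do not change along `w`.
    perturb : ∀ {w} → FaceDirection x∈GT w → ∃[ ε ] Positive ε × (λ a → x a + ε * w a) ∈ F₀
    perturb {w} w-dir = ε , ε-pos , z∈GT , z-tight
      where
      module W = FaceDirection w-dir

      InequalitiesAt : Cell n × Cell n → Pred Carrier 0ℓ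
      InequalitiesAt (a , b) ε = (a UpTo b → x a + ε * w a ≤ x b + ε * w b)
                               × (a DiagTo b → x b + ε * w b ≤ x a + ε * w a)

      small : ∀ ab → ∃[ ε₀ ] Positive ε₀ × (∀ {ε} → 0# ≤ ε → ε ≤ ε₀ → InequalitiesAt ab ε)
      small (a , b) with a UpTo? b | a DiagTo? b
      ... | yes up | _ =
        let ε₀ , pos , bound = perturb-≤ (w a) (w b) (IsGTPattern.up isGTPattern up) (λ eq → W.tight (inj₁ up , eq))
        in ε₀ , pos , λ 0≤ε ε≤ε₀ → (λ _ → bound 0≤ε ε≤ε₀) ,
             -- No pair is related in both ways, since the columns would have to be equal and also
             -- differ by one.
             λ diag → contradiction (≡.trans (≡.sym (proj₁ diag)) (proj₁ up)) ℕ.1+n≢n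
      ... | no ¬up | yes diag =
        let ε₀ , pos , bound = perturb-≤ (w b) (w a) (IsGTPattern.diag isGTPattern diag)
                                 (λ eq → sym (W.tight (inj₂ diag , sym eq)))
        in ε₀ , pos , λ 0≤ε ε≤ε₀ → (λ up → contradiction up ¬up) , λ _ → bound 0≤ε ε≤ε₀
      ... | no ¬up | no ¬diag = 1# , 1-positive , λ _ _ →
        (λ up → contradiction up ¬up) , λ diag → contradiction diag ¬diag

      common = common-ε InequalitiesAt small cellPairs
      ε = proj₁ common
      ε-pos = proj₁ (proj₂ common)

      inequalities : ∀ a b → InequalitiesAt (a , b) ε
      inequalities a b = All.lookup (proj₂ (proj₂ common) (proj₁ ε-pos) ≤-refl) (∈-cellPairs a b)

      z : X n
      z a = x a + ε * w a

      fixed : ∀ {t u} → u ≈ 0# → t + ε * u ≈ t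
      fixed {t} u≈0 = trans (+-congˡ (trans (*-congˡ u≈0) (zeroʳ ε))) (+-identityʳ t)

      z-rowSum : ∀ j → rowSum z j ≈ rowSum x j
      z-rowSum j = trans (trans (R.+ᴹ-homo x (λ a → ε * w a)) (+-congˡ (R.*ₗ-homo ε w))) (fixed (W.weight j))
        where module R = LinearFunctional (linear-rowSum j)

      z∈GT : z ∈ GT lam μ
      z∈GT = record
        { isGTPattern = record
          -- On the top row `z` agrees with `x`, and the diagonal inequalities pass nonnegativity
          -- down.
          { nonNeg = nonNeg-from-top (λ {a} {b} → proj₂ (inequalities a b))
              (λ a a-top → ≤-respʳ-≈ (sym (fixed (W.top a a-top))) (nonNeg a))
          ; up   = λ {a} {b} → proj₁ (inequalities a b)
          ; diag = λ {a} {b} → proj₂ (inequalities a b)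
          }
        ; top    = λ a k a-top col≡ → trans (fixed (W.top a a-top)) (top a k a-top col≡)
        ; bottom = λ a a-bot → trans (fixed (W.bottom a a-bot)) (bottom a a-bot)
        ; weight = λ j j⁺ eq → trans (+-cong (z-rowSum j⁺) (-‿cong (z-rowSum j))) (weight j j⁺ eq)
        }

      z-tight : ∀ {a b} → Tight x∈GT a b → z a ≈ z b
      z-tight ab = +-cong (proj₂ ab) (*-congˡ (W.tight ab))

    -- With `z = x + ε w` in the face and `η = 1/ε`, the affine combination `η z + (1 - η) x` equals
    -- `x + w`; subtracting `x` leaves `w`.
    FaceDirection⇒direction : FaceDirection x∈GT ⊆ direction (affineHull F₀)
    FaceDirection⇒direction {w} w-dir
      with ε , (_ , ε≉0) , z∈F₀ ← perturb w-dir
      with η , εη≈1 ← inverse ε ε≉0 =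
      combination c p , x , (2 , c , p , p∈F₀ , ∑c≈1 , λ _ → refl) ,
      ⊆-affineHull F₀ (x∈minimalFace x∈GT) , w≈
      where
      c : Vector Carrier 2
      c zero    = η
      c (suc _) = 1# - η
      p : Vector (X n) 2
      p zero    = λ a → x a + ε * w a
      p (suc _) = x
      p∈F₀ : ∀ k → p k ∈ F₀
      p∈F₀ zero    = z∈F₀
      p∈F₀ (suc _) = x∈minimalFace x∈GT
      ∑c≈1 : sum c ≈ 1#
      ∑c≈1 = trans (+-congˡ (+-identityʳ _)) (y+[x-y]≈x 1# η)
      w≈ : ∀ a → w a ≈ combination c p a - x a
      w≈ a = sym (begin
        η * (x a + ε * w a) + ((1# - η) * x a + 0#) - x a
          ≈⟨ +-congʳ (+-cong η*z (+-identityʳ _)) ⟩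
        w a + η * x a + (1# - η) * x a - x a
          ≈⟨ +-congʳ (+-assoc _ _ _) ⟩
        w a + (η * x a + (1# - η) * x a) - x a
          ≈⟨ +-congʳ (+-congˡ (distribʳ _ _ _)) ⟨
        w a + (η + (1# - η)) * x a - x a
          ≈⟨ +-congʳ (+-congˡ (trans (*-congʳ (y+[x-y]≈x 1# η)) (*-identityˡ _))) ⟩
        w a + x a - x a
          ≈⟨ trans (+-assoc _ _ _) (trans (+-congˡ (-‿inverseʳ _)) (+-identityʳ _)) ⟩
        w a
          ∎)
        where
        η*z : η * (x a + ε * w a) ≈ w a + η * x a
        η*z = begin
          η * (x a + ε * w a)      ≈⟨ distribˡ _ _ _ ⟩
          η * x a + η * (ε * w a)  ≈⟨ +-comm _ _ ⟩
          η * (ε * w a) + η * x a  ≈⟨ +-congʳ (*-assoc _ _ _) ⟨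
          η * ε * w a + η * x a    ≈⟨ +-congʳ (trans (*-congʳ (trans (*-comm η ε) εη≈1)) (*-identityˡ _)) ⟩
          w a + η * x a            ∎

    -- For y in the minimal face, x lies strictly between y and x + ε (x - y), so a
    -- functional maximised over GT at x takes the same value at y.
    minimalFace-least : ∀ {G} → IsFaceOf (GT lam μ) G → x ∈ G → F₀ ⊆ G
    minimalFace-least {G} (f , c , lf , f≤c , G⊆ , ⊆G) x∈G {y} y∈F₀
      with ε , (0≤ε , ε≉0) , (z∈GT , _) ← perturb {λ a → x a - y a} (direction⇒FaceDirection
             (x , y , ⊆-affineHull F₀ (x∈minimalFace x∈GT) , ⊆-affineHull F₀ y∈F₀ , λ _ → refl)) =
      ⊆G (proj₁ y∈F₀ , trans (sym fx≈fy) fx≈c)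
      where
      module L = LinearFunctional lf
      w : X n
      w a = x a - y a
      fx≈c : f x ≈ c
      fx≈c = proj₂ (G⊆ x∈G)
      -- The bound `f ≤ c` at `y` gives `0 ≤ f w`, and the same bound at `x + ε w` gives
      -- `ε * f w ≤ 0`; hence `f w` is zero.
      fw≈ : f w ≈ f x - f y
      fw≈ = trans (L.+ᴹ-homo x (λ a → - y a)) (+-congˡ (L.-ᴹ-homo y))
      0≤fw : 0# ≤ f w
      0≤fw = ≤-respʳ-≈ (trans (+-congʳ (sym fx≈c)) (sym fw≈)) (x≤y⇒0≤y-x (f≤c (proj₁ y∈F₀)))
      c+εfw≤c : c + ε * f w ≤ c
      c+εfw≤c = ≤-respˡ-≈ (trans (L.+ᴹ-homo x (λ a → ε * w a)) (+-cong fx≈c (L.*ₗ-homo ε w))) (f≤c z∈GT)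
      εfw≤0 : ε * f w ≤ 0#
      εfw≤0 = ≤-respˡ-≈ (xyx⁻¹≈y c (ε * f w)) (≤-respʳ-≈ (-‿inverseʳ c) (+-monoˡ-≤ (- c) c+εfw≤c))
      fx≈fy : f x ≈ f y
      fx≈fy = x∙y⁻¹≈ε⇒x≈y _ _ (trans (sym fw≈) (*-cancelˡ-0 ε≉0 (antisym εfw≤0 (*-nonNeg 0≤ε 0≤fw))))

    minimalFace-isMinimal : IsMinimalFace (GT lam μ) x F₀
    minimalFace-isMinimal = record
      { isFace            = minimalFace-isFace x∈GT
      ; contains          = x∈minimalFace x∈GT
      ; least             = minimalFace-least
      ; lowestDimensional = λ G-face x∈G →
          dimension-mono (direction-affineHull-mono F₀ _ (minimalFace-least G-face x∈G))
      }

    -- Both are faces through `x`, and each is contained in every such face.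
    minimalFace-unique : ∀ {F} → IsMinimalFace (GT lam μ) x F → F₀ ≐ F
    minimalFace-unique F-min = minimalFace-least isFace contains , least (minimalFace-isFace x∈GT) (x∈minimalFace x∈GT)
      where open IsMinimalFace F-min

  -- Free tiles

  fromℕ-count : ∀ {A : Set} {Q : Pred A 0ℓ} (Q? : Decidable Q) {m} (f : Fin m → A) →
                fromℕ (count Q? (tabulate f)) ≈ sum (λ i → indicator (Q? (f i)))
  fromℕ-count Q? {zero}  f = refl
  fromℕ-count Q? {suc m} f with Q? (f zero)
  ... | yes _ = +-congˡ (fromℕ-count Q? (f ∘ suc))
  ... | no  _ = trans (fromℕ-count Q? (f ∘ suc)) (sym (+-identityˡ _))

  module _ {n} {x : X n} where

    SameTile-sym : ∀ {a b} → SameTile x a b → SameTile x b a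
    SameTile-sym = Star.reverse (λ (xb≈xa , adj) → sym xb≈xa , Adjacent-sym adj)

    module _ (𝒫 : FreeTiles x) where
      open FreeTiles 𝒫

      representative : Fin s → Cell n
      representative k = proj₁ (proj₁ (isFree k))

      P⇒SameTile : ∀ {k a b} → a ∈ P k → b ∈ P k → SameTile x a b
      P⇒SameTile {k} a∈ b∈ = SameTile-sym (⊆tile a∈) ◅◅ ⊆tile b∈
        where ⊆tile = proj₁ (proj₂ (proj₁ (isFree k)))

      P-respects-SameTile : ∀ {k a b} → SameTile x a b → a ∈ P k → b ∈ P k
      P-respects-SameTile {k} a~b a∈ = proj₂ tile (proj₁ tile a∈ ◅◅ a~b)
        where tile = proj₂ (proj₁ (isFree k))

      representative∈P : ∀ k → representative k ∈ P k
      representative∈P k = proj₂ (proj₂ (proj₁ (isFree k))) Star.ε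

      -- Tiles are equivalence classes, so two with a common cell coincide, and the listing has no
      -- repetitions.
      P-disjoint : ∀ {k l a} → a ∈ P k → a ∈ P l → k ≡ l
      P-disjoint a∈k a∈l = distinct
        ( (λ b∈k → P-respects-SameTile (P⇒SameTile a∈k b∈k) a∈l)
        , (λ b∈l → P-respects-SameTile (P⇒SameTile a∈l b∈l) a∈k))

      characteristic : Vector (X n) s
      characteristic k a = indicator (P? k a)

      combination-∈ : ∀ v {k a} → a ∈ P k → combination v characteristic a ≈ v k
      combination-∈ v {k} {a} a∈k = trans
        (sum-single (λ l → v l * characteristic l a) k
          (λ l l≢k → trans (*-congˡ (indicator-no (P? l a) (λ a∈l → l≢k (P-disjoint a∈l a∈k)))) (zeroʳ _)))
        (trans (*-congˡ (indicator-yes (P? k a) a∈k)) (*-identityʳ _))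

      combination-∉ : ∀ v {a} → (∀ k → ¬ (a ∈ P k)) → combination v characteristic a ≈ 0#
      combination-∉ v {a} a∉ = sum-zero (λ k → trans (*-congˡ (indicator-no (P? k a) (a∉ k))) (zeroʳ _))

      -- By disjointness, evaluating a combination at a cell of the tile `P k` isolates the
      -- coefficient of index `k`.
      characteristic-independent : LinearlyIndependent characteristic
      characteristic-independent v comb≈0 k =
        trans (sym (combination-∈ v (representative∈P k))) (comb≈0 (representative k))

      rowSum-combination : ∀ v (j : InnerRow n) →
        rowSum (combination v characteristic) (proj₁ j) ≈ applyMatrix (tilingMatrix 𝒫) v j
      rowSum-combination v (j , _) = begin
        sum (λ i → sum (λ k → v k * characteristic k (j , i)))
          ≈⟨ ∑-comm (λ i k → v k * characteristic k (j , i)) ⟩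
        sum (λ k → sum (λ i → v k * characteristic k (j , i)))
          ≈⟨ sum-cong-≋ (λ k → *-distribˡ-sum (v k) (λ i → characteristic k (j , i))) ⟨
        sum (λ k → v k * sum (λ i → characteristic k (j , i)))
          ≈⟨ sum-cong-≋ (λ k → trans (*-comm _ _) (*-congʳ (sym (fromℕ-count (λ i → P? k (j , i)) id)))) ⟩
        sum (λ k → fromℕ (count (λ i → P? k (j , i)) (Vec.allFin _)) * v k)
          ∎

      -- Free tiles miss the first and the last row, so the equations of those rows hold
      -- automatically. Indexing the equations by all of `Fin n` gives the system the form expected
      -- by `solution-dimension`.
      kernel≐ : (λ v → ∀ j → rowSum (combination v characteristic) j ≈ 0#) ≐ kernel (tilingMatrix 𝒫)
      kernel≐ = (λ {v} v∈ j → trans (sym (rowSum-combination v j)) (v∈ (proj₁ j))) , from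
        where
        from : ∀ {v} → v ∈ kernel (tilingMatrix 𝒫) → ∀ j → rowSum (combination v characteristic) j ≈ 0#
        from {v} v∈ j with 2 ℕ.≤? suc (toℕ j) | suc (toℕ j) ℕ.<? n
        ... | yes 2≤j | yes j<n = trans (rowSum-combination v (j , 2≤j , j<n)) (v∈ (j , 2≤j , j<n))
        ... | no 2≰j  | _       = sum-zero (λ i → combination-∉ v {j , i}
          (λ k a∈ → proj₁ (proj₂ (isFree k) a∈) (ℕ.≤-antisym (ℕ.≤-pred (ℕ.≰⇒> 2≰j)) (s≤s z≤n))))
        ... | _       | no j≮n  = sum-zero (λ i → combination-∉ v {j , i}
          (λ k a∈ → proj₂ (proj₂ (isFree k) a∈) (ℕ.≤-antisym (Fin.toℕ<n j) (ℕ.≮⇒≥ j≮n))))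

      -- Face directions and the kernel of the tiling matrix

      module _ {lam μ : Vector ℤ n} (x∈GT : x ∈ GT lam μ) where

        kernel⇒FaceDirection : ∀ {v} → (∀ j → rowSum (combination v characteristic) j ≈ 0#) →
                               FaceDirection x∈GT (combination v characteristic)
        kernel⇒FaceDirection {v} v∈ = record
          { tight  = λ ab → sum-cong-≋ (λ k → *-congˡ (characteristic-tight k ab))
          ; top    = λ a a-top → combination-∉ v (λ k a∈ → proj₂ (proj₂ (isFree k) a∈) a-top)
          ; bottom = λ a a-bot → combination-∉ v (λ k a∈ → proj₁ (proj₂ (isFree k) a∈) a-bot)
          ; weight = v∈
          }
          where
          characteristic-tight : ∀ k {a b} → Tight x∈GT a b → characteristic k a ≈ characteristic k b
          characteristic-tight k {a} {b} (a⋖b , xa≈xb) = by-cases (P? k a)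
            where
            a~b : SameTile x a b
            a~b = (sym xa≈xb , ⋖⇒Adjacent a⋖b) ◅ Star.ε
            by-cases : Dec (a ∈ P k) → characteristic k a ≈ characteristic k b
            by-cases (yes a∈) = trans (indicator-yes (P? k a) a∈)
              (sym (indicator-yes (P? k b) (P-respects-SameTile a~b a∈)))
            by-cases (no a∉)  = trans (indicator-no (P? k a) a∉)
              (sym (indicator-no (P? k b) (λ b∈ → a∉ (P-respects-SameTile (SameTile-sym a~b) b∈))))

        -- Each step of the chain joins adjacent cells with equal entries, which form a tight pair
        -- after orienting the step upwards.
        FaceDirection-const : ∀ {w} → FaceDirection x∈GT w → ∀ {a b} → SameTile x a b → w b ≈ w a
        FaceDirection-const w-dir Star.ε = refl
        FaceDirection-const w-dir ((xb≈xa , adj) ◅ b~c) = trans (FaceDirection-const w-dir b~c) (step xb≈xa adj)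
          where
          open FaceDirection w-dir
          step : ∀ {a b} → x b ≈ x a → Adjacent a b → _
          step xb≈xa (inj₁ diag)               = sym (tight (inj₂ diag , sym xb≈xa))
          step xb≈xa (inj₂ (inj₁ up))          = sym (tight (inj₁ up , sym xb≈xa))
          step xb≈xa (inj₂ (inj₂ (inj₁ diag))) = tight (inj₂ diag , xb≈xa)
          step xb≈xa (inj₂ (inj₂ (inj₂ up)))   = tight (inj₁ up , xb≈xa)

        -- If w a ≉ 0 then w ≉ 0 on the whole tile of a, which is therefore free.
        FaceDirection-∉ : ∀ {w a} → FaceDirection x∈GT w → (∀ k → ¬ (a ∈ P k)) → w a ≈ 0#
        FaceDirection-∉ {w} {a} w-dir a∉ = decidable-stable (w a ≟ 0#) λ wa≉0 →
          let k , tile⊆ , _ = exhaustive {SameTile x a} ((a , id , id) , λ {b} a~b →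
                (λ b-bot → wa≉0 (trans (sym (FaceDirection-const w-dir a~b)) (bottom b b-bot))) ,
                (λ b-top → wa≉0 (trans (sym (FaceDirection-const w-dir a~b)) (top b b-top))))
          in a∉ k (tile⊆ Star.ε)
          where open FaceDirection w-dir

        -- The coefficient of a free tile is the value of `w` at its representative; `w` is constant
        -- on each free tile and zero off all of them.
        FaceDirection⇒kernel : ∀ {w} → FaceDirection x∈GT w →
          ∃[ v ] (∀ j → rowSum (combination v characteristic) j ≈ 0#) × (∀ a → w a ≈ combination v characteristic a)
        FaceDirection⇒kernel {w} w-dir = v , (λ j → trans (sum-cong-≋ (λ i → sym (w≈ (j , i)))) (weight j)) , w≈
          where
          open FaceDirection w-dir
          v : Vector Carrier s
          v k = w (representative k)
          w≈ : ∀ a → w a ≈ combination v characteristic a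
          w≈ a with Fin.any? (λ k → P? k a)
          ... | yes (k , a∈) = trans (FaceDirection-const w-dir (P⇒SameTile (representative∈P k) a∈))
                                     (sym (combination-∈ v a∈))
          ... | no a∉ = trans (FaceDirection-∉ w-dir (λ k a∈ → a∉ (k , a∈)))
                              (sym (combination-∉ v (λ k a∈ → a∉ (k , a∈))))

        -- A basis of the kernel comes from its defining equations, and the combinations of tile
        -- indicators carry it to a basis of the direction space.
        kernel-dimension : ∃[ d ] HasDimension (kernel (tilingMatrix 𝒫)) d
                                × HasDimension (direction (affineHull (minimalFace x∈GT))) d
        kernel-dimension
          with d , dim , _ ← solution-dimension (λ j v → rowSum (combination v characteristic) j)
                               (λ j → linear-sum (λ i → linear-combination characteristic (j , i))) =
          d , HasDimension-resp-≐ kernel≐ dim ,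
          image-dimension characteristic characteristic-independent
            (λ v∈ → FaceDirection⇒direction x∈GT (kernel⇒FaceDirection v∈))
            (λ w∈ → FaceDirection⇒kernel (direction⇒FaceDirection x∈GT w∈)) dim

theorem1p5 : (ℝ : RealField) → let open GelfandTsetlin ℝ in
    ∀ (n : ℕ) (lam μ : Vector ℤ n) (x : X n) → x ∈ GT lam μ →
    ∀ (𝒫 : FreeTiles x) →
    (∃[ F ] IsMinimalFace (GT lam μ) x F)
    × (∀ F → IsMinimalFace (GT lam μ) x F →
    ∃[ d ] HasDimension (kernel (tilingMatrix 𝒫)) d × HasAffineDimension F d)
theorem1p5 ℝ n lam μ x x∈GT 𝒫 =
  (minimalFace ℝ x∈GT , minimalFace-isMinimal ℝ x∈GT) ,
  -- Any minimal face has the same points as `minimalFace`, hence the same direction space, and the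
  -- dimension carries over.
  λ F F-min →
    let d , kernel-dim , face-dim = kernel-dimension ℝ 𝒫 x∈GT
        F₀⊆F , F⊆F₀ = minimalFace-unique ℝ x∈GT F-min
        F₀ = minimalFace ℝ x∈GT
    in d , kernel-dim , HasDimension-resp-≐ ℝ
         (direction-affineHull-mono ℝ F₀ F F₀⊆F , direction-affineHull-mono ℝ F F₀ F⊆F₀) face-dim
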